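{- Over $\mathrm{HA}^\omega$, Spector's (restricted) bar recursion $\mathsf{SBR}$ is $T$-definable from the dependent explicitly controlled product of selection functions $\mathsf{EPS}$; that is, $\mathsf{EPS}\geq_T\mathsf{SBR}$.
   Context: Types and systems. Finite types are generated from $\mathbb{B}$ (booleans) and $\mathbb{N}$ by $X\times Y$, $X\to Y$ and $X^*$ (finite sequences). For a sequence of types $(X_i)_{i\in\mathbb{N}}$, $\Pi_i X_i$ is the type of infinite sequences whose $i$-th entry is in $X_i$ and $\Pi_{i<n}X_i$ the type of finite sequences of length $n$. (This is used for readability; one may take all $X_i$ equal to one type $X$, reading $\Pi_iX_i$ as $\mathbb{N}\to X$ and finite sequence types as $X^*$.) $\mathrm{HA}^\omega$ is Heyting arithmetic in all finite types with fully extensional equality (Troelstra's E-$\mathrm{HA}^\omega$); system $T$ is its quantifier-free fragment (Gödel's primitive recursive functionals). $\mathbf{0}$ denotes the canonical zero object of each type (the zero sequence for sequence types). Notation. $*$ is concatenation; $|s|$ is the length of $s$; $q_s(\alpha)=q(s*\alpha)$, $q_x=q_{\langle x\rangle}$. $J_RX=(X\to R)\to X$. For a finite sequence $s\colon\Pi_{i<|s|}X_i$ and $\alpha\colon\Pi_iX_i$, the overwriting $s\,@\,\alpha\colon\Pi_iX_i$ is $(s\,@\,\alpha)(i)=s_i$ if $i<|s|$ and $(s\,@\,\alpha)(i)=\alpha(i)$ otherwise. $T$-definability. A functional is specified by a defining equation (for each choice of type parameters). $G$ is $T$-definable from $F$ over a theory $\mathcal{S}$ (written $F\ge_T G$) if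 for each choice of types for $G$ there are a choice of types for $F$ and a term $s$ of system $T$ such that $s(F)$ satisfies the defining equation of $G$, provably in $\mathcal{S}$ together with the defining equation of $F$. $\mathsf{EPS}$. For $\varepsilon\colon\Pi_k(\Pi_{i<k}X_i\to J_RX_k)$ (so $\varepsilon_s\colon J_RX_{|s|}$ for a finite sequence $s\colon\Pi_{i<|s|}X_i$), $\ell\colon R\to\mathbb{N}$, $q\colon\Pi_iX_{|s|+i}\to R$, the value $\mathsf{EPS}^\ell_s(\varepsilon)(q)\colon\Pi_iX_{|s|+i}$ is specified by: $\mathsf{EPS}^\ell_s(\varepsilon)(q)=\mathbf{0}$ if $\ell(q(\mathbf{0}))<|s|$, and otherwise $\mathsf{EPS}^\ell_s(\varepsilon)(q)=c*\mathsf{EPS}^\ell_{s*c}(\varepsilon)(q_c)$, where $c=\varepsilon_s(\lambda x.\,q_x(\mathsf{EPS}^\ell_{s*x}(\varepsilon)(q_x)))$. $\mathsf{SBR}$. For $\varepsilon_s\colon J_{\Pi_iX_i}X_{|s|}$ (for each finite sequence $s$) and $\omega\colon\Pi_iX_i\to\mathbb{N}$, the value $\mathsf{SBR}^\omega_s(\varepsilon)\colon\Pi_iX_i$ is specified by: $\mathsf{SBR}^\omega_s(\varepsilon)=s\,@\,\mathbf{0}$ if $\omega_s(\mathbf{0})<|s|$, and otherwise $\mathsf{SBR}^\omega_s(\varepsilon)=s\,@\,\mathsf{SBR}^\omega_{s*c}(\varepsilon)$, where $c=\varepsilon_s(\lambda x^{X_{|s|}}.\,\mathsf{SBR}^\omega_{s*x}(\varepsilon))$.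 -}

module Defs where

open import Data.List.Base using (List; []; _∷_; map)
open import Data.List.Membership.Propositional using (_∈_)
open import Data.List.Relation.Unary.Any using (here; there)
open import Data.Product.Base using (_×_; _,_; Σ-syntax)
open import Relation.Binary.PropositionalEquality using (refl)

infixr 7 _⇒_
infixr 8 _⊗_
infix  9 _*

data Ty : Set where
  𝔹 ℕ : Ty
  _⊗_ : Ty → Ty → Ty
  _⇒_ : Ty → Ty → Ty
  _*  : Ty → Ty

-- All entries of a sequence have the same type X, so that Π_i X_i is ℕ ⇒ X
-- and the finite sequences with entries in the X_i form X *.

_^ω : Ty → Ty
X ^ω = ℕ ⇒ X

J : Ty → Ty → Ty
J R X = (X ⇒ R) ⇒ X

Ctx : Set
Ctx = List Ty

variable
  Γ Δ   : Ctx
  A B X : Ty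

infixl 20 _·_
infix  15 if_then_else_

-- System T.  `rec` and `fold` are the primitive recursors, at every result
-- type, for numbers and for finite sequences.

data Tm (Γ : Ctx) : Ty → Set where
  var           : A ∈ Γ → Tm Γ A
  ƛ_            : Tm (A ∷ Γ) B → Tm Γ (A ⇒ B)
  _·_           : Tm Γ (A ⇒ B) → Tm Γ A → Tm Γ B
  pair          : Tm Γ A → Tm Γ B → Tm Γ (A ⊗ B)
  fst           : Tm Γ (A ⊗ B) → Tm Γ A
  snd           : Tm Γ (A ⊗ B) → Tm Γ B
  true false    : Tm Γ 𝔹
  if_then_else_ : Tm Γ 𝔹 → Tm Γ A → Tm Γ A → Tm Γ A
  zero          : Tm Γ ℕ
  suc           : Tm Γ ℕ → Tm Γ ℕ
  rec           : Tm Γ A → Tm Γ (ℕ ⇒ A ⇒ A) → Tm Γ ℕ → Tm Γ A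
  nil           : Tm Γ (X *)
  cons          : Tm Γ X → Tm Γ (X *) → Tm Γ (X *)
  fold          : Tm Γ A → Tm Γ (X ⇒ X * ⇒ A ⇒ A) → Tm Γ (X *) → Tm Γ A

infixr 6 ƛ_

pattern v₀ = var (here refl)
pattern v₁ = var (there (here refl))
pattern v₂ = var (there (there (here refl)))
pattern v₃ = var (there (there (there (here refl))))
pattern v₄ = var (there (there (there (there (here refl)))))

Ren : Ctx → Ctx → Set
Ren Γ Δ = ∀ {A} → A ∈ Γ → A ∈ Δ

Sub : Ctx → Ctx → Set
Sub Γ Δ = ∀ {A} → A ∈ Γ → Tm Δ A

liftᴿ : Ren Γ Δ → Ren (A ∷ Γ) (A ∷ Δ)
liftᴿ ρ (here refl) = here refl
liftᴿ ρ (there x)   = there (ρ x)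

ren : Ren Γ Δ → Tm Γ A → Tm Δ A
ren ρ (var x)                = var (ρ x)
ren ρ (ƛ t)                  = ƛ ren (liftᴿ ρ) t
ren ρ (t · u)                = ren ρ t · ren ρ u
ren ρ (pair t u)             = pair (ren ρ t) (ren ρ u)
ren ρ (fst t)                = fst (ren ρ t)
ren ρ (snd t)                = snd (ren ρ t)
ren ρ true                   = true
ren ρ false                  = false
ren ρ (if b then t else u)   = if ren ρ b then ren ρ t else ren ρ u
ren ρ zero                   = zero
ren ρ (suc t)                = suc (ren ρ t)
ren ρ (rec z f n)            = rec (ren ρ z) (ren ρ f) (ren ρ n)
ren ρ nil                    = nil
ren ρ (cons t u)             = cons (ren ρ t) (ren ρ u)
ren ρ (fold z f s)           = fold (ren ρ z) (ren ρ f) (ren ρ s)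

wk : Tm Γ B → Tm (A ∷ Γ) B
wk = ren there

lift : Sub Γ Δ → Sub (A ∷ Γ) (A ∷ Δ)
lift σ (here refl) = v₀
lift σ (there x)   = wk (σ x)

sub : Sub Γ Δ → Tm Γ A → Tm Δ A
sub σ (var x)                = σ x
sub σ (ƛ t)                  = ƛ sub (lift σ) t
sub σ (t · u)                = sub σ t · sub σ u
sub σ (pair t u)             = pair (sub σ t) (sub σ u)
sub σ (fst t)                = fst (sub σ t)
sub σ (snd t)                = snd (sub σ t)
sub σ true                   = true
sub σ false                  = false
sub σ (if b then t else u)   = if sub σ b then sub σ t else sub σ u
sub σ zero                   = zero
sub σ (suc t)                = suc (sub σ t)
sub σ (rec z f n)            = rec (sub σ z) (sub σ f) (sub σ n)
sub σ nil                    = nil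
sub σ (cons t u)             = cons (sub σ t) (sub σ u)
sub σ (fold z f s)           = fold (sub σ z) (sub σ f) (sub σ s)

infixl 5 _▸_

_▸_ : Sub Γ Δ → Tm Δ A → Sub (A ∷ Γ) Δ
(σ ▸ t) (here refl) = t
(σ ▸ t) (there x)   = σ x

_[_] : Tm (A ∷ Γ) B → Tm Γ A → Tm Γ B
t [ u ] = sub (var ▸ u) t

infix  12 _≐_
infixr 11 _∧_
infixr 10 _∨_
infixr 9  _⊃_

data Fm (Γ : Ctx) : Set where
  _≐_         : Tm Γ A → Tm Γ A → Fm Γ
  ⊥           : Fm Γ
  _∧_ _∨_ _⊃_ : Fm Γ → Fm Γ → Fm Γ
  all ex      : (A : Ty) → Fm (A ∷ Γ) → Fm Γ

subᶠ : Sub Γ Δ → Fm Γ → Fm Δ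
subᶠ σ (t ≐ u)   = sub σ t ≐ sub σ u
subᶠ σ ⊥         = ⊥
subᶠ σ (φ ∧ ψ)   = subᶠ σ φ ∧ subᶠ σ ψ
subᶠ σ (φ ∨ ψ)   = subᶠ σ φ ∨ subᶠ σ ψ
subᶠ σ (φ ⊃ ψ)   = subᶠ σ φ ⊃ subᶠ σ ψ
subᶠ σ (all A φ) = all A (subᶠ (lift σ) φ)
subᶠ σ (ex A φ)  = ex A (subᶠ (lift σ) φ)

renᶠ : Ren Γ Δ → Fm Γ → Fm Δ
renᶠ ρ (t ≐ u)   = ren ρ t ≐ ren ρ u
renᶠ ρ ⊥         = ⊥
renᶠ ρ (φ ∧ ψ)   = renᶠ ρ φ ∧ renᶠ ρ ψ
renᶠ ρ (φ ∨ ψ)   = renᶠ ρ φ ∨ renᶠ ρ ψ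
renᶠ ρ (φ ⊃ ψ)   = renᶠ ρ φ ⊃ renᶠ ρ ψ
renᶠ ρ (all A φ) = all A (renᶠ (liftᴿ ρ) φ)
renᶠ ρ (ex A φ)  = ex A (renᶠ (liftᴿ ρ) φ)

wkᶠ : Fm Γ → Fm (A ∷ Γ)
wkᶠ = renᶠ there

_[_]ᶠ : Fm (A ∷ Γ) → Tm Γ A → Fm Γ
φ [ t ]ᶠ = subᶠ (var ▸ t) φ

-- A set of axioms; an axiom with free variables stands for its closure.

Theory : Set₁
Theory = ∀ {Γ} → Fm Γ → Set

infix 4 _∣_⊢_

-- Intuitionistic many-sorted logic with equality at every type.

data _∣_⊢_ (𝒮 : Theory) {Γ : Ctx} (Φ : List (Fm Γ)) : Fm Γ → Set where
  ax   : ∀ {φ} → 𝒮 φ → 𝒮 ∣ Φ ⊢ φ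
  hyp  : ∀ {φ} → φ ∈ Φ → 𝒮 ∣ Φ ⊢ φ
  ⊥E   : ∀ {φ} → 𝒮 ∣ Φ ⊢ ⊥ → 𝒮 ∣ Φ ⊢ φ
  ∧I   : ∀ {φ ψ} → 𝒮 ∣ Φ ⊢ φ → 𝒮 ∣ Φ ⊢ ψ → 𝒮 ∣ Φ ⊢ φ ∧ ψ
  ∧E₁  : ∀ {φ ψ} → 𝒮 ∣ Φ ⊢ φ ∧ ψ → 𝒮 ∣ Φ ⊢ φ
  ∧E₂  : ∀ {φ ψ} → 𝒮 ∣ Φ ⊢ φ ∧ ψ → 𝒮 ∣ Φ ⊢ ψ
  ∨I₁  : ∀ {φ ψ} → 𝒮 ∣ Φ ⊢ φ → 𝒮 ∣ Φ ⊢ φ ∨ ψ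
  ∨I₂  : ∀ {φ ψ} → 𝒮 ∣ Φ ⊢ ψ → 𝒮 ∣ Φ ⊢ φ ∨ ψ
  ∨E   : ∀ {φ ψ χ} → 𝒮 ∣ Φ ⊢ φ ∨ ψ → 𝒮 ∣ φ ∷ Φ ⊢ χ → 𝒮 ∣ ψ ∷ Φ ⊢ χ → 𝒮 ∣ Φ ⊢ χ
  ⊃I   : ∀ {φ ψ} → 𝒮 ∣ φ ∷ Φ ⊢ ψ → 𝒮 ∣ Φ ⊢ φ ⊃ ψ
  ⊃E   : ∀ {φ ψ} → 𝒮 ∣ Φ ⊢ φ ⊃ ψ → 𝒮 ∣ Φ ⊢ φ → 𝒮 ∣ Φ ⊢ ψ
  ∀I   : ∀ {φ : Fm (A ∷ Γ)} → 𝒮 ∣ map wkᶠ Φ ⊢ φ → 𝒮 ∣ Φ ⊢ all A φ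
  ∀E   : ∀ {φ : Fm (A ∷ Γ)} → 𝒮 ∣ Φ ⊢ all A φ → (t : Tm Γ A) → 𝒮 ∣ Φ ⊢ φ [ t ]ᶠ
  ∃I   : ∀ {φ : Fm (A ∷ Γ)} (t : Tm Γ A) → 𝒮 ∣ Φ ⊢ φ [ t ]ᶠ → 𝒮 ∣ Φ ⊢ ex A φ
  ∃E   : ∀ {φ : Fm (A ∷ Γ)} {ψ} →
         𝒮 ∣ Φ ⊢ ex A φ → 𝒮 ∣ φ ∷ map wkᶠ Φ ⊢ wkᶠ ψ → 𝒮 ∣ Φ ⊢ ψ
  ≐I   : ∀ {t : Tm Γ A} → 𝒮 ∣ Φ ⊢ t ≐ t
  ≐E   : ∀ {t u : Tm Γ A} (φ : Fm (A ∷ Γ)) →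
         𝒮 ∣ Φ ⊢ t ≐ u → 𝒮 ∣ Φ ⊢ φ [ t ]ᶠ → 𝒮 ∣ Φ ⊢ φ [ u ]ᶠ

-- E-HA^ω: by `ext`, equality at function types is extensional.
-- In `ind` and `ind*` the induction step lives in the context extended by
-- the eigenvariables (n, respectively x and then s).

data HAω {Γ : Ctx} : Fm Γ → Set where
  β       : (t : Tm (A ∷ Γ) B) (u : Tm Γ A) → HAω ((ƛ t) · u ≐ t [ u ])
  ext     : (f g : Tm Γ (A ⇒ B)) →
            HAω (all A (wk f · v₀ ≐ wk g · v₀) ⊃ f ≐ g)

  β-fst   : (t : Tm Γ A) (u : Tm Γ B) → HAω (fst (pair t u) ≐ t)
  β-snd   : (t : Tm Γ A) (u : Tm Γ B) → HAω (snd (pair t u) ≐ u)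
  η-pair  : (t : Tm Γ (A ⊗ B)) → HAω (pair (fst t) (snd t) ≐ t)

  if-t    : (t u : Tm Γ A) → HAω ((if true then t else u) ≐ t)
  if-f    : (t u : Tm Γ A) → HAω ((if false then t else u) ≐ u)
  true≢false : HAω (true ≐ false ⊃ ⊥)
  case    : (φ : Fm (𝔹 ∷ Γ)) → HAω (φ [ true ]ᶠ ⊃ φ [ false ]ᶠ ⊃ all 𝔹 φ)

  suc-inj : (m n : Tm Γ ℕ) → HAω (suc m ≐ suc n ⊃ m ≐ n)
  suc≢0   : (n : Tm Γ ℕ) → HAω (suc n ≐ zero ⊃ ⊥)
  rec-0   : (z : Tm Γ A) (f : Tm Γ (ℕ ⇒ A ⇒ A)) → HAω (rec z f zero ≐ z)
  rec-s   : (z : Tm Γ A) (f : Tm Γ (ℕ ⇒ A ⇒ A)) (n : Tm Γ ℕ) →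
            HAω (rec z f (suc n) ≐ f · n · rec z f n)
  ind     : (φ : Fm (ℕ ∷ Γ)) →
            HAω (φ [ zero ]ᶠ
                 ⊃ all ℕ (φ ⊃ subᶠ ((λ x → var (there x)) ▸ suc v₀) φ)
                 ⊃ all ℕ φ)

  fold-n  : (z : Tm Γ A) (f : Tm Γ (X ⇒ X * ⇒ A ⇒ A)) → HAω (fold z f nil ≐ z)
  fold-c  : (z : Tm Γ A) (f : Tm Γ (X ⇒ X * ⇒ A ⇒ A)) (x : Tm Γ X) (s : Tm Γ (X *)) →
            HAω (fold z f (cons x s) ≐ f · x · s · fold z f s)
  ind*    : (φ : Fm (X * ∷ Γ)) →
            HAω (φ [ nil ]ᶠ
                 ⊃ all X (all (X *)
                     (subᶠ ((λ x → var (there (there x))) ▸ v₀) φ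
                      ⊃ subᶠ ((λ x → var (there (there x))) ▸ cons v₁ v₀) φ))
                 ⊃ all (X *) φ)

-- The functional itself is the only free variable of its defining equation.
-- `equation p` is the universal closure of the equation in its arguments.

record Functional : Set₁ where
  field
    Param    : Set
    type     : Param → Ty
    equation : (p : Param) → Fm (type p ∷ [])

open Functional

_≥T_over_ : Functional → Functional → Theory → Set
F ≥T G over 𝒮 =
  (p : Param G) →
  Σ[ r ∈ Param F ] Σ[ t ∈ Tm [] (type F r ⇒ type G p) ]
    𝒮 ∣ equation F r ∷ [] ⊢ subᶠ ((λ ()) ▸ wk t · v₀) (equation G p)

𝟎 : Tm Γ A
𝟎 {A = 𝔹}     = false
𝟎 {A = ℕ}     = zero
𝟎 {A = A ⊗ B} = pair 𝟎 𝟎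
𝟎 {A = A ⇒ B} = ƛ 𝟎
𝟎 {A = X *}   = nil

infix  16 _<ᵇ_
infixr 18 _⋆_ _++_ _＠_
infix  21 _⟪_⟫
infix  19 _‼_

-- 0 < 0 is false, 0 < n + 1 is true, m + 1 < 0 is false,
-- and m + 1 < n + 1 is m < n.

_<ᵇ_ : Tm Γ ℕ → Tm Γ ℕ → Tm Γ 𝔹
m <ᵇ n = lt · m · n
  where
  lt : Tm Γ (ℕ ⇒ ℕ ⇒ 𝔹)
  lt = ƛ rec (ƛ rec false (ƛ ƛ true) v₀)
             (ƛ ƛ ƛ rec false (ƛ ƛ v₃ · v₁) v₀)
             v₀

∣_∣ : Tm Γ (X *) → Tm Γ ℕ
∣ s ∣ = (ƛ fold zero (ƛ ƛ ƛ suc v₀) v₀) · s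

⟨_⟩ : Tm Γ X → Tm Γ (X *)
⟨ x ⟩ = cons x nil

_++_ : Tm Γ (X *) → Tm Γ (X *) → Tm Γ (X *)
s ++ t = (ƛ ƛ fold v₀ (ƛ ƛ ƛ cons v₂ v₀) v₁) · s · t

-- Concatenation of a finite and an infinite sequence: nil ⋆ α is α, and
-- (cons x s ⋆ α) has x at position 0 and (s ⋆ α)(j) at position j + 1.

_⋆_ : Tm Γ (X *) → Tm Γ (X ^ω) → Tm Γ (X ^ω)
s ⋆ α = (ƛ ƛ fold v₀ (ƛ ƛ ƛ ƛ rec v₃ (ƛ ƛ v₃ · v₁) v₀) v₁) · s · α

-- The entry s_i, only meant for i < ∣ s ∣.

_‼_ : Tm Γ (X *) → Tm Γ ℕ → Tm Γ X
s ‼ i = (s ⋆ 𝟎) · i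

_＠_ : Tm Γ (X *) → Tm Γ (X ^ω) → Tm Γ (X ^ω)
s ＠ α = (ƛ ƛ ƛ (if v₀ <ᵇ ∣ v₂ ∣ then v₂ ‼ v₀ else v₁ · v₀)) · s · α

-- The notation q_s; here s is a finite sequence, and q_x is q ⟪ ⟨ x ⟩ ⟫.

_⟪_⟫ : Tm Γ (X ^ω ⇒ A) → Tm Γ (X *) → Tm Γ (X ^ω ⇒ A)
q ⟪ s ⟫ = (ƛ ƛ ƛ v₂ · (v₁ ⋆ v₀)) · q · s

-- EPS^ℓ_s(ε)(q) is written F · ℓ · s · ε · q, and ε_s is ε · s.

EPSTy : Ty → Ty → Ty
EPSTy X R = (R ⇒ ℕ) ⇒ X * ⇒ (X * ⇒ J R X) ⇒ (X ^ω ⇒ R) ⇒ X ^ω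

EPSEq : ∀ {X R} → Tm Γ (EPSTy X R) → Tm Γ (R ⇒ ℕ) → Tm Γ (X *) →
        Tm Γ (X * ⇒ J R X) → Tm Γ (X ^ω ⇒ R) → Fm Γ
EPSEq F ℓ s ε q =
  F · ℓ · s · ε · q
    ≐ (if ℓ · (q · 𝟎) <ᵇ ∣ s ∣
       then 𝟎
       else ⟨ c ⟩ ⋆ (F · ℓ · (s ++ ⟨ c ⟩) · ε · q ⟪ ⟨ c ⟩ ⟫))
  where
  c = ε · s · (ƛ (wk q ⟪ ⟨ v₀ ⟩ ⟫)
                 · (wk F · wk ℓ · (wk s ++ ⟨ v₀ ⟩) · wk ε · (wk q ⟪ ⟨ v₀ ⟩ ⟫)))

EPS : Functional
EPS = record
  { Param    = Ty × Ty
  ; type     = λ (X , R) → EPSTy X R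
  ; equation = λ (X , R) →
      all (R ⇒ ℕ) (all (X *) (all (X * ⇒ J R X) (all (X ^ω ⇒ R)
        (EPSEq v₄ v₃ v₂ v₁ v₀))))
  }

-- SBR^ω_s(ε) is written F · ω · s · ε.

SBRTy : Ty → Ty
SBRTy X = (X ^ω ⇒ ℕ) ⇒ X * ⇒ (X * ⇒ J (X ^ω) X) ⇒ X ^ω

SBREq : Tm Γ (SBRTy X) → Tm Γ (X ^ω ⇒ ℕ) → Tm Γ (X *) →
        Tm Γ (X * ⇒ J (X ^ω) X) → Fm Γ
SBREq F ω s ε =
  F · ω · s · ε
    ≐ (if (ω ⟪ s ⟫) · 𝟎 <ᵇ ∣ s ∣
       then s ＠ 𝟎
       else s ＠ (F · ω · (s ++ ⟨ c ⟩) · ε))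
  where
  c = ε · s · (ƛ wk F · wk ω · (wk s ++ ⟨ v₀ ⟩) · wk ε)

SBR : Functional
SBR = record
  { Param    = Ty
  ; type     = SBRTy
  ; equation = λ X →
      all (X ^ω ⇒ ℕ) (all (X *) (all (X * ⇒ J (X ^ω) X)
        (SBREq v₃ v₂ v₁ v₀)))
  }

{-# OPTIONS --safe #-}

-- SBR^ω_s(ε) is s ⋆ EPS^ω_s(ε)(λ α. s ⋆ α), with R = X^ω and control ω:
-- the equation of EPS turns into that of SBR because (λ α. s ⋆ α)_x is
-- λ α. (s ++ ⟨ x ⟩) ⋆ α and because overwriting s ⋆ β by s changes nothing.

module Submission where

open import Data.List.Base using (List; []; _∷_; map)
open import Data.List.Membership.Propositional using (_∈_)
open import Data.List.Relation.Unary.Any using (here; there)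
open import Data.Product.Base using (_×_; _,_; Σ-syntax)
open import Relation.Binary.Bundles using (Setoid)
open import Relation.Binary.PropositionalEquality
  using (_≡_; refl; sym; trans; cong; cong₂; subst; subst₂)
import Relation.Binary.Reasoning.Setoid as SetoidReasoning

open import Defs

private variable
  Θ   : Ctx
  C D : Ty
  Φ   : List (Fm Γ)

-- Substitution calculus

cong₃ : ∀ {P Q R S : Set} (f : P → Q → R → S) {a a′ b b′ c c′} →
        a ≡ a′ → b ≡ b′ → c ≡ c′ → f a b c ≡ f a′ b′ c′
cong₃ f refl refl refl = refl

-- Renamings are handled as substitutions by variables, so that fusion needs an induction for `sub`
-- only. The hypothesis is pointwise, since functions on variables are compared through their
-- values.
sub-as-ren : {σ : Sub Γ Δ} {ρ : Ren Γ Δ} →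
             (∀ {A} (x : A ∈ Γ) → σ x ≡ var (ρ x)) →
             (t : Tm Γ A) → sub σ t ≡ ren ρ t

lift-as-liftᴿ : {σ : Sub Γ Δ} {ρ : Ren Γ Δ} →
                (∀ {A} (x : A ∈ Γ) → σ x ≡ var (ρ x)) →
                ∀ {A} (x : A ∈ B ∷ Γ) → lift σ x ≡ var (liftᴿ ρ x)
lift-as-liftᴿ e (here refl) = refl
lift-as-liftᴿ e (there x)   = cong wk (e x)

sub-as-ren e (var x)              = e x
sub-as-ren e (ƛ t)                = cong ƛ_ (sub-as-ren (lift-as-liftᴿ e) t)
sub-as-ren e (t · u)              = cong₂ _·_ (sub-as-ren e t) (sub-as-ren e u)
sub-as-ren e (pair t u)           = cong₂ pair (sub-as-ren e t) (sub-as-ren e u)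
sub-as-ren e (fst t)              = cong fst (sub-as-ren e t)
sub-as-ren e (snd t)              = cong snd (sub-as-ren e t)
sub-as-ren e true                 = refl
sub-as-ren e false                = refl
sub-as-ren e (if b then t else u) =
  cong₃ if_then_else_ (sub-as-ren e b) (sub-as-ren e t) (sub-as-ren e u)
sub-as-ren e zero                 = refl
sub-as-ren e (suc t)              = cong suc (sub-as-ren e t)
sub-as-ren e (rec z f n)          =
  cong₃ rec (sub-as-ren e z) (sub-as-ren e f) (sub-as-ren e n)
sub-as-ren e nil                  = refl
sub-as-ren e (cons t u)           = cong₂ cons (sub-as-ren e t) (sub-as-ren e u)
sub-as-ren e (fold z f s)         =
  cong₃ fold (sub-as-ren e z) (sub-as-ren e f) (sub-as-ren e s)

lift-id : {σ : Sub Γ Γ} → (∀ {A} (x : A ∈ Γ) → σ x ≡ var x) →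
          ∀ {A} (x : A ∈ B ∷ Γ) → lift σ x ≡ var x
lift-id e (here refl) = refl
lift-id e (there x)   = cong wk (e x)

sub-id : {σ : Sub Γ Γ} → (∀ {A} (x : A ∈ Γ) → σ x ≡ var x) →
         (t : Tm Γ A) → sub σ t ≡ t
sub-id e (var x)              = e x
sub-id e (ƛ t)                = cong ƛ_ (sub-id (lift-id e) t)
sub-id e (t · u)              = cong₂ _·_ (sub-id e t) (sub-id e u)
sub-id e (pair t u)           = cong₂ pair (sub-id e t) (sub-id e u)
sub-id e (fst t)              = cong fst (sub-id e t)
sub-id e (snd t)              = cong snd (sub-id e t)
sub-id e true                 = refl
sub-id e false                = refl
sub-id e (if b then t else u) =
  cong₃ if_then_else_ (sub-id e b) (sub-id e t) (sub-id e u)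
sub-id e zero                 = refl
sub-id e (suc t)              = cong suc (sub-id e t)
sub-id e (rec z f n)          = cong₃ rec (sub-id e z) (sub-id e f) (sub-id e n)
sub-id e nil                  = refl
sub-id e (cons t u)           = cong₂ cons (sub-id e t) (sub-id e u)
sub-id e (fold z f s)         = cong₃ fold (sub-id e z) (sub-id e f) (sub-id e s)

-- One induction serves the fusion of substitutions with renamings on either
-- side and of two substitutions: only the proof that the relation between
-- the three substitutions is preserved by `lift` differs.

module Fusion
  (R : ∀ {Γ Δ Θ} → Sub Γ Δ → Sub Δ Θ → Sub Γ Θ → Set)
  (R-lift : ∀ {Γ Δ Θ B} (σ : Sub Γ Δ) (τ : Sub Δ Θ) (υ : Sub Γ Θ) →
            R σ τ υ → R (lift {A = B} σ) (lift τ) (lift υ))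
  (R-var : ∀ {Γ Δ Θ} (σ : Sub Γ Δ) (τ : Sub Δ Θ) (υ : Sub Γ Θ) →
           R σ τ υ → ∀ {A} (x : A ∈ Γ) → sub τ (σ x) ≡ υ x)
  where

  fuse : {σ : Sub Γ Δ} {τ : Sub Δ Θ} {υ : Sub Γ Θ} → R σ τ υ →
         (t : Tm Γ A) → sub τ (sub σ t) ≡ sub υ t
  fuse r (var x)              = R-var _ _ _ r x
  fuse r (ƛ t)                = cong ƛ_ (fuse (R-lift _ _ _ r) t)
  fuse r (t · u)              = cong₂ _·_ (fuse r t) (fuse r u)
  fuse r (pair t u)           = cong₂ pair (fuse r t) (fuse r u)
  fuse r (fst t)              = cong fst (fuse r t)
  fuse r (snd t)              = cong snd (fuse r t)
  fuse r true                 = refl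
  fuse r false                = refl
  fuse r (if b then t else u) = cong₃ if_then_else_ (fuse r b) (fuse r t) (fuse r u)
  fuse r zero                 = refl
  fuse r (suc t)              = cong suc (fuse r t)
  fuse r (rec z f n)          = cong₃ rec (fuse r z) (fuse r f) (fuse r n)
  fuse r nil                  = refl
  fuse r (cons t u)           = cong₂ cons (fuse r t) (fuse r u)
  fuse r (fold z f s)         = cong₃ fold (fuse r z) (fuse r f) (fuse r s)

-- Going under a binder decides the order of the three instances: with a renaming first, congruence
-- of `wk` suffices; with a renaming last, `lift-wk` is needed, which the former provides; two
-- arbitrary substitutions need both.
module Renaming-first where

  R : Sub Γ Δ → Sub Δ Θ → Sub Γ Θ → Set
  R {Γ} {Δ} σ τ υ =
    Σ[ ρ ∈ Ren Γ Δ ] (∀ {A} (x : A ∈ Γ) → σ x ≡ var (ρ x))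
                   × (∀ {A} (x : A ∈ Γ) → τ (ρ x) ≡ υ x)

  R-lift : (σ : Sub Γ Δ) (τ : Sub Δ Θ) (υ : Sub Γ Θ) →
           R σ τ υ → R (lift {A = B} σ) (lift τ) (lift υ)
  R-lift σ τ υ (ρ , e , f) =
    liftᴿ ρ , lift-as-liftᴿ e ,
    λ { (here refl) → refl ; (there x) → cong wk (f x) }

  R-var : (σ : Sub Γ Δ) (τ : Sub Δ Θ) (υ : Sub Γ Θ) →
          R σ τ υ → ∀ {A} (x : A ∈ Γ) → sub τ (σ x) ≡ υ x
  R-var σ τ υ (ρ , e , f) x = trans (cong (sub τ) (e x)) (f x)

  open Fusion R R-lift R-var public

sub-ren : {ρ : Ren Γ Δ} {τ : Sub Δ Θ} {υ : Sub Γ Θ} →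
          (∀ {A} (x : A ∈ Γ) → τ (ρ x) ≡ υ x) →
          (t : Tm Γ A) → sub τ (ren ρ t) ≡ sub υ t
sub-ren {ρ = ρ} {τ} {υ} e t =
  trans (cong (sub τ) (sym (sub-as-ren {σ = λ x → var (ρ x)} (λ _ → refl) t)))
        (Renaming-first.fuse {υ = υ} (ρ , (λ _ → refl) , e) t)

ren-wk : (ρ : Ren (B ∷ Γ) Δ) (t : Tm Γ A) →
         ren ρ (wk t) ≡ sub (λ x → var (ρ (there x))) t
ren-wk ρ t = trans (sym (sub-as-ren (λ _ → refl) (wk t))) (sub-ren (λ _ → refl) t)

module Renaming-last where

  R : Sub Γ Δ → Sub Δ Θ → Sub Γ Θ → Set
  R {Γ} {Δ} {Θ} σ τ υ =
    Σ[ ρ ∈ Ren Δ Θ ] (∀ {A} (x : A ∈ Δ) → τ x ≡ var (ρ x))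
                   × (∀ {A} (x : A ∈ Γ) → sub τ (σ x) ≡ υ x)

  lift-wk : {τ : Sub Γ Δ} {ρ : Ren Γ Δ} →
            (∀ {A} (x : A ∈ Γ) → τ x ≡ var (ρ x)) →
            (t : Tm Γ A) → sub (lift {A = B} τ) (wk t) ≡ wk (sub τ t)
  lift-wk {τ = τ} {ρ} e t =
    trans (sub-ren {υ = λ x → wk (τ x)} (λ _ → refl) t)
          -- Here `τ` is itself a renaming, so weakening after `τ` is again a fusion with a renaming
          -- first, and no circularity arises.
          (trans (sym (Renaming-first.fuse
                    {σ = τ} {λ x → var (there x)} {λ x → wk (τ x)}
                    (ρ , e , λ x → sym (cong wk (e x))) t))
                 (sub-as-ren (λ _ → refl) (sub τ t)))

  R-lift : (σ : Sub Γ Δ) (τ : Sub Δ Θ) (υ : Sub Γ Θ) →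
           R σ τ υ → R (lift {A = B} σ) (lift τ) (lift υ)
  R-lift σ τ υ (ρ , e , f) =
    liftᴿ ρ , lift-as-liftᴿ e ,
    λ { (here refl) → refl ; (there x) → trans (lift-wk e (σ x)) (cong wk (f x)) }

  R-var : (σ : Sub Γ Δ) (τ : Sub Δ Θ) (υ : Sub Γ Θ) →
          R σ τ υ → ∀ {A} (x : A ∈ Γ) → sub τ (σ x) ≡ υ x
  R-var σ τ υ (ρ , e , f) = f

  open Fusion R R-lift R-var public

wk-sub : (σ : Sub Γ Δ) (t : Tm Γ A) →
         wk {A = B} (sub σ t) ≡ sub (λ x → wk (σ x)) t
wk-sub σ t =
  trans (sym (sub-as-ren (λ _ → refl) (sub σ t)))
        (Renaming-last.fuse {σ = σ} {λ x → var (there x)} {λ x → wk (σ x)}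
          (there , (λ _ → refl) , λ x → sub-as-ren (λ _ → refl) (σ x)) t)

module Substitutions where

  R : Sub Γ Δ → Sub Δ Θ → Sub Γ Θ → Set
  R {Γ} σ τ υ = ∀ {A} (x : A ∈ Γ) → sub τ (σ x) ≡ υ x

  R-lift : (σ : Sub Γ Δ) (τ : Sub Δ Θ) (υ : Sub Γ Θ) →
           R σ τ υ → R (lift {A = B} σ) (lift τ) (lift υ)
  R-lift σ τ υ e (here refl) = refl
  R-lift σ τ υ e (there x) =
    trans (sub-ren {υ = λ y → wk (τ y)} (λ _ → refl) (σ x))
          (trans (sym (wk-sub τ (σ x))) (cong wk (e x)))

  R-var : (σ : Sub Γ Δ) (τ : Sub Δ Θ) (υ : Sub Γ Θ) →
          R σ τ υ → ∀ {A} (x : A ∈ Γ) → sub τ (σ x) ≡ υ x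
  R-var σ τ υ e = e

  open Fusion R R-lift R-var public

sub-sub : {σ : Sub Γ Δ} {τ : Sub Δ Θ} {υ : Sub Γ Θ} →
          (∀ {A} (x : A ∈ Γ) → sub τ (σ x) ≡ υ x) →
          (t : Tm Γ A) → sub τ (sub σ t) ≡ sub υ t
sub-sub {σ = σ} {τ} {υ} = Substitutions.fuse {σ = σ} {τ} {υ}

subᶠ-subᶠ : {σ : Sub Γ Δ} {τ : Sub Δ Θ} {υ : Sub Γ Θ} →
            (∀ {A} (x : A ∈ Γ) → sub τ (σ x) ≡ υ x) →
            (φ : Fm Γ) → subᶠ τ (subᶠ σ φ) ≡ subᶠ υ φ
subᶠ-subᶠ e (t ≐ u)   = cong₂ _≐_ (sub-sub e t) (sub-sub e u)
subᶠ-subᶠ e ⊥         = refl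
subᶠ-subᶠ e (φ ∧ ψ)   = cong₂ _∧_ (subᶠ-subᶠ e φ) (subᶠ-subᶠ e ψ)
subᶠ-subᶠ e (φ ∨ ψ)   = cong₂ _∨_ (subᶠ-subᶠ e φ) (subᶠ-subᶠ e ψ)
subᶠ-subᶠ e (φ ⊃ ψ)   = cong₂ _⊃_ (subᶠ-subᶠ e φ) (subᶠ-subᶠ e ψ)
subᶠ-subᶠ e (all A φ) = cong (all A) (subᶠ-subᶠ (Substitutions.R-lift _ _ _ e) φ)
subᶠ-subᶠ e (ex A φ)  = cong (ex A) (subᶠ-subᶠ (Substitutions.R-lift _ _ _ e) φ)

subᶠ-as-renᶠ : {σ : Sub Γ Δ} {ρ : Ren Γ Δ} →
               (∀ {A} (x : A ∈ Γ) → σ x ≡ var (ρ x)) →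
               (φ : Fm Γ) → subᶠ σ φ ≡ renᶠ ρ φ
subᶠ-as-renᶠ e (t ≐ u)   = cong₂ _≐_ (sub-as-ren e t) (sub-as-ren e u)
subᶠ-as-renᶠ e ⊥         = refl
subᶠ-as-renᶠ e (φ ∧ ψ)   = cong₂ _∧_ (subᶠ-as-renᶠ e φ) (subᶠ-as-renᶠ e ψ)
subᶠ-as-renᶠ e (φ ∨ ψ)   = cong₂ _∨_ (subᶠ-as-renᶠ e φ) (subᶠ-as-renᶠ e ψ)
subᶠ-as-renᶠ e (φ ⊃ ψ)   = cong₂ _⊃_ (subᶠ-as-renᶠ e φ) (subᶠ-as-renᶠ e ψ)
subᶠ-as-renᶠ e (all A φ) = cong (all A) (subᶠ-as-renᶠ (lift-as-liftᴿ e) φ)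
subᶠ-as-renᶠ e (ex A φ)  = cong (ex A) (subᶠ-as-renᶠ (lift-as-liftᴿ e) φ)

wkᶠ-subᶠ : (σ : Sub Γ Δ) (φ : Fm Γ) →
           wkᶠ {A = A} (subᶠ σ φ) ≡ subᶠ (λ x → wk (σ x)) φ
wkᶠ-subᶠ σ φ =
  trans (sym (subᶠ-as-renᶠ (λ _ → refl) (subᶠ σ φ)))
        (subᶠ-subᶠ (λ x → sub-as-ren (λ _ → refl) (σ x)) φ)

sub-wk : (u : Tm Γ B) (t : Tm Γ A) → wk t [ u ] ≡ t
sub-wk u t = trans (sub-ren {υ = var} (λ _ → refl) t) (sub-id (λ _ → refl) t)

-- The bridge between the axioms and quantifier rules, which instantiate one variable by `_[_]`, and
-- the simultaneous substitutions in which the derived rules are phrased.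
lift-▸ : (σ : Sub Γ Δ) (u : Tm Δ B) →
         ∀ {A} (x : A ∈ B ∷ Γ) → sub (var ▸ u) (lift σ x) ≡ (σ ▸ u) x
lift-▸ σ u (here refl) = refl
lift-▸ σ u (there x)   = sub-wk u (σ x)

-- Zero objects and the overwriting operator under substitution.

sub-𝟎 : (σ : Sub Γ Δ) → ∀ {A} → sub σ (𝟎 {A = A}) ≡ 𝟎
sub-𝟎 σ {𝔹}     = refl
sub-𝟎 σ {ℕ}     = refl
sub-𝟎 σ {A ⊗ B} = cong₂ pair (sub-𝟎 σ) (sub-𝟎 σ)
sub-𝟎 σ {A ⇒ B} = cong ƛ_ (sub-𝟎 (lift σ))
sub-𝟎 σ {X *}   = refl

ren-𝟎 : (ρ : Ren Γ Δ) → ren ρ (𝟎 {A = A}) ≡ 𝟎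
ren-𝟎 ρ = trans (sym (sub-as-ren (λ _ → refl) 𝟎)) (sub-𝟎 (λ x → var (ρ x)))

-- The closed operator at the head of `s ＠ α`. Its entry lookup contains `𝟎` at the arbitrary type
-- `X`, where substitution is stuck until the type is known; its invariance is therefore proved once
-- and applied as an equation.
overwrite : Tm Γ (X * ⇒ X ^ω ⇒ X ^ω)
overwrite = ƛ ƛ ƛ (if v₀ <ᵇ ∣ v₂ ∣ then v₂ ‼ v₀ else v₁ · v₀)

sub-overwrite : (σ : Sub Γ Δ) → sub σ (overwrite {X = X}) ≡ overwrite
sub-overwrite σ =
  cong (λ z → ƛ ƛ ƛ (if v₀ <ᵇ ∣ v₂ ∣ then (v₂ ⋆ (ƛ z)) · v₀ else v₁ · v₀)) (sub-𝟎 _)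

wk-overwrite : wk {A = A} (overwrite {Γ} {X}) ≡ overwrite
wk-overwrite =
  trans (sym (sub-as-ren (λ _ → refl) overwrite)) (sub-overwrite (λ x → var (there x)))

wk-＠ : (s : Tm Γ (X *)) (α : Tm Γ (X ^ω)) → wk {A = A} (s ＠ α) ≡ wk s ＠ wk α
wk-＠ s α = cong (λ o → o · wk s · wk α) wk-overwrite

∅ : Sub [] Γ
∅ ()

cast : {φ ψ : Fm Γ} → φ ≡ ψ → HAω ∣ Φ ⊢ φ → HAω ∣ Φ ⊢ ψ
cast refl d = d

-- Derived rules.  They are stated for instances `sub σ t` of a term t: when t
-- is given explicitly the instance computes, so that no substitution lemma is
-- needed where a rule is applied.

-- Leibniz's law for an equation whose left side is weakened, hence fixed at `u`, while the right
-- side varies with the replaced variable; at `u` it is reflexivity.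
cong▸ : (σ : Sub Γ Δ) (t : Tm (A ∷ Γ) B) {u v : Tm Δ A} →
        HAω ∣ Φ ⊢ u ≐ v → HAω ∣ Φ ⊢ sub (σ ▸ u) t ≐ sub (σ ▸ v) t
cong▸ σ t {u} {v} d =
  cast (cong₂ _≐_ (sub-wk v (sub (σ ▸ u) t)) (sub-sub (lift-▸ σ v) t))
    (≐E (wk (sub (σ ▸ u) t) ≐ sub (lift σ) t) d
      (cast (sym (cong₂ _≐_ (sub-wk u (sub (σ ▸ u) t)) (sub-sub (lift-▸ σ u) t))) ≐I))

≐-sym : {t u : Tm Γ A} → HAω ∣ Φ ⊢ t ≐ u → HAω ∣ Φ ⊢ u ≐ t
≐-sym {t = t} {u} d =
  cast (cong (u ≐_) (sub-wk u t))
       (≐E (v₀ ≐ wk t) d (cast (cong (t ≐_) (sym (sub-wk t t))) ≐I))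

≐-trans : {t u v : Tm Γ A} →
          HAω ∣ Φ ⊢ t ≐ u → HAω ∣ Φ ⊢ u ≐ v → HAω ∣ Φ ⊢ t ≐ v
≐-trans {t = t} {u} {v} d e =
  cast (cong (_≐ v) (sub-wk v t))
       (≐E (wk t ≐ v₀) e (cast (cong (_≐ u) (sym (sub-wk u t))) d))

≐-reflexive : {t u : Tm Γ A} → t ≡ u → HAω ∣ Φ ⊢ t ≐ u
≐-reflexive refl = ≐I

≐-setoid : ∀ {Γ} → List (Fm Γ) → Ty → Setoid _ _
≐-setoid {Γ} Φ A = record
  { Carrier       = Tm Γ A
  ; _≈_           = λ t u → HAω ∣ Φ ⊢ t ≐ u
  ; isEquivalence = record { refl = ≐I ; sym = ≐-sym ; trans = ≐-trans }
  }

module ≐-Reasoning {Γ} {Φ : List (Fm Γ)} {A} = SetoidReasoning (≐-setoid Φ A)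

·-congˡ : {f g : Tm Γ (A ⇒ B)} {a : Tm Γ A} →
          HAω ∣ Φ ⊢ f ≐ g → HAω ∣ Φ ⊢ f · a ≐ g · a
·-congˡ {a = a} = cong▸ (∅ ▸ a) (v₀ · v₁)

·-congʳ : {f : Tm Γ (A ⇒ B)} {a b : Tm Γ A} →
          HAω ∣ Φ ⊢ a ≐ b → HAω ∣ Φ ⊢ f · a ≐ f · b
·-congʳ {f = f} = cong▸ (∅ ▸ f) (v₁ · v₀)

·-cong : {f g : Tm Γ (A ⇒ B)} {a b : Tm Γ A} →
         HAω ∣ Φ ⊢ f ≐ g → HAω ∣ Φ ⊢ a ≐ b → HAω ∣ Φ ⊢ f · a ≐ g · b
·-cong d e = ≐-trans (·-congˡ d) (·-congʳ e)

if-cong : {b c : Tm Γ 𝔹} {t u v w : Tm Γ A} →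
          HAω ∣ Φ ⊢ b ≐ c → HAω ∣ Φ ⊢ t ≐ u → HAω ∣ Φ ⊢ v ≐ w →
          HAω ∣ Φ ⊢ (if b then t else v) ≐ (if c then u else w)
if-cong {c = c} {t} {u} {v} d e f =
  ≐-trans (cong▸ (∅ ▸ t ▸ v) (if v₀ then v₂ else v₁) d)
    (≐-trans (cong▸ (∅ ▸ c ▸ v) (if v₂ then v₀ else v₁) e)
             (cong▸ (∅ ▸ c ▸ u) (if v₂ then v₁ else v₀) f))

⟨⟩-cong : {x y : Tm Γ X} → HAω ∣ Φ ⊢ x ≐ y → HAω ∣ Φ ⊢ ⟨ x ⟩ ≐ ⟨ y ⟩
⟨⟩-cong = cong▸ ∅ ⟨ v₀ ⟩

β▸ : (σ : Sub Γ Δ) (t : Tm (A ∷ Γ) B) {a : Tm Δ A} →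
     HAω ∣ Φ ⊢ sub σ (ƛ t) · a ≐ sub (σ ▸ a) t
β▸ σ t {a} =
  cast (cong (sub σ (ƛ t) · a ≐_) (sub-sub (lift-▸ σ a) t)) (ax (β (sub (lift σ) t) a))

β▸₂ : (σ : Sub Γ Δ) (t : Tm (B ∷ A ∷ Γ) C) {a : Tm Δ A} {b : Tm Δ B} →
      HAω ∣ Φ ⊢ sub σ (ƛ ƛ t) · a · b ≐ sub (σ ▸ a ▸ b) t
β▸₂ σ t = ≐-trans (·-congˡ (β▸ σ (ƛ t))) (β▸ (σ ▸ _) t)

β▸₃ : (σ : Sub Γ Δ) (t : Tm (C ∷ B ∷ A ∷ Γ) D)
      {a : Tm Δ A} {b : Tm Δ B} {c : Tm Δ C} →
      HAω ∣ Φ ⊢ sub σ (ƛ ƛ ƛ t) · a · b · c ≐ sub (σ ▸ a ▸ b ▸ c) t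
β▸₃ σ t = ≐-trans (·-congˡ (β▸₂ σ (ƛ t))) (β▸ (σ ▸ _ ▸ _) t)

∀E▸ : (σ : Sub Γ Δ) (φ : Fm (A ∷ Γ)) → HAω ∣ Φ ⊢ subᶠ σ (all A φ) →
      (t : Tm Δ A) → HAω ∣ Φ ⊢ subᶠ (σ ▸ t) φ
∀E▸ σ φ d t = cast (subᶠ-subᶠ (lift-▸ σ t) φ) (∀E d t)

∀E▸₄ : (σ : Sub Γ Δ) (φ : Fm (D ∷ C ∷ B ∷ A ∷ Γ)) →
       HAω ∣ Φ ⊢ subᶠ σ (all A (all B (all C (all D φ)))) →
       (a : Tm Δ A) (b : Tm Δ B) (c : Tm Δ C) (d : Tm Δ D) →
       HAω ∣ Φ ⊢ subᶠ (σ ▸ a ▸ b ▸ c ▸ d) φ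
∀E▸₄ σ φ p a b c d =
  ∀E▸ (σ ▸ a ▸ b ▸ c) φ
    (∀E▸ (σ ▸ a ▸ b) (all _ φ)
      (∀E▸ (σ ▸ a) (all _ (all _ φ))
        (∀E▸ σ (all _ (all _ (all _ φ))) p a) b) c) d

case▸ : (σ : Sub Γ Δ) (φ : Fm (𝔹 ∷ Γ)) →
        HAω ∣ Φ ⊢ subᶠ (σ ▸ true) φ → HAω ∣ Φ ⊢ subᶠ (σ ▸ false) φ →
        (b : Tm Δ 𝔹) → HAω ∣ Φ ⊢ subᶠ (σ ▸ b) φ
case▸ {Φ = Φ} σ φ d e =
  ∀E▸ σ φ (⊃E (⊃E (ax (case (subᶠ (lift σ) φ))) (inst true d)) (inst false e))
  where
  inst : ∀ b → HAω ∣ Φ ⊢ subᶠ (σ ▸ b) φ → HAω ∣ Φ ⊢ subᶠ (lift σ) φ [ b ]ᶠ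
  inst b = cast (sym (subᶠ-subᶠ (lift-▸ σ b) φ))

ind*▸ : (σ : Sub Γ Δ) (φ : Fm (X * ∷ Γ)) →
        HAω ∣ Φ ⊢ subᶠ (σ ▸ nil) φ →
        HAω ∣ subᶠ ((λ x → wk (wk (σ x))) ▸ v₀) φ ∷ map wkᶠ (map wkᶠ Φ)
          ⊢ subᶠ ((λ x → wk (wk (σ x))) ▸ cons v₁ v₀) φ →
        (s : Tm Δ (X *)) → HAω ∣ Φ ⊢ subᶠ (σ ▸ s) φ
ind*▸ {X = X} {Φ = Φ} σ φ d e =
  ∀E▸ σ φ
    (⊃E (⊃E (ax (ind* (subᶠ (lift σ) φ)))
            (cast (sym (subᶠ-subᶠ (lift-▸ σ nil) φ)) d))
        (∀I (∀I (⊃I (subst₂ (λ χ ψ → HAω ∣ χ ∷ map wkᶠ (map wkᶠ Φ) ⊢ ψ)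
                            (eq v₀) (eq (cons v₁ v₀)) e)))))
  where
  -- The axiom substitutes into `subᶠ (lift σ) φ`, the rule directly into `φ`. On the parameters in
  -- `σ` the two differ only in whether they shift past the eigenvariables in one renaming or by two
  -- weakenings.
  eq : ∀ s → subᶠ ((λ x → wk (wk (σ x))) ▸ s) φ
           ≡ subᶠ ((λ x → var (there (there x))) ▸ s) (subᶠ (lift σ) φ)
  eq s = sym (subᶠ-subᶠ
    (λ { (here refl) → refl
       ; (there x)   → trans (sub-ren (λ _ → refl) (σ x)) (sym (ren-wk there (σ x))) }) φ)

-- Extensionality reduces the claim to a fresh argument, where β recovers the two bodies. It permits
-- rewriting inside the function handed to a selection function.
ξ : {t u : Tm (A ∷ Γ) B} → HAω ∣ map wkᶠ Φ ⊢ t ≐ u → HAω ∣ Φ ⊢ (ƛ t) ≐ (ƛ u)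
ξ {Γ = Γ} {Φ = Φ} {t} {u} d =
  ⊃E (ax (ext (ƛ t) (ƛ u)))
     (∀I (≐-trans (unwk t) (≐-trans d (≐-sym (unwk u)))))
  where
  unwk : ∀ t → HAω ∣ map wkᶠ Φ ⊢ wk (ƛ t) · v₀ ≐ t
  unwk t = ≐-trans (ax (β _ _)) (≐-reflexive
    (trans (sub-ren {υ = var} (λ { (here refl) → refl ; (there x) → refl }) t)
           (sub-id (λ _ → refl) t)))

-- f′ and g′ are there because `wk` does not compute on 𝟎.

ext-ℕ : {f g : Tm Γ (ℕ ⇒ A)} {f′ g′ : Tm (ℕ ∷ Γ) (ℕ ⇒ A)} →
        wk f ≡ f′ → wk g ≡ g′ →
        HAω ∣ Φ ⊢ f · zero ≐ g · zero →
        HAω ∣ f′ · v₀ ≐ g′ · v₀ ∷ map wkᶠ Φ ⊢ f′ · suc v₀ ≐ g′ · suc v₀ →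
        HAω ∣ Φ ⊢ f ≐ g
ext-ℕ {f = f} {g} refl refl d e =
  ⊃E (ax (ext f g))
     (⊃E (⊃E (ax (ind (wk f · v₀ ≐ wk g · v₀)))
             (cast (sym (cong₂ (λ a b → a · zero ≐ b · zero)
                               (sub-wk zero f) (sub-wk zero g))) d))
         (∀I (⊃I (cast (cong₂ (λ a b → a · suc v₀ ≐ b · suc v₀) (eq f) (eq g)) e))))
  where
  eq : ∀ t → wk t ≡ sub ((λ x → var (there x)) ▸ suc v₀) (wk t)
  eq t = sym (trans (sub-ren {υ = λ x → var (there x)} (λ _ → refl) t)
                    (sub-as-ren (λ _ → refl) t))

-- Finite and infinite sequences

module _ {Γ} {Φ : List (Fm Γ)} where

  open ≐-Reasoning

  private
    -- The recursion inside `_<ᵇ_` with its branches named: its values are functions of the second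
    -- number, `lt₀` for zero and `lt₁` for a successor, given the function of the predecessor.
    lt₀ : ∀ {Δ} → Tm Δ (ℕ ⇒ 𝔹)
    lt₀ = ƛ rec false (ƛ ƛ true) v₀

    lt₁-body : ∀ {Δ} → Tm (ℕ ∷ (ℕ ⇒ 𝔹) ∷ Δ) 𝔹
    lt₁-body = rec false (ƛ ƛ v₃ · v₁) v₀

    lt₁ : ∀ {Δ} → Tm Δ (ℕ ⇒ (ℕ ⇒ 𝔹) ⇒ ℕ ⇒ 𝔹)
    lt₁ = ƛ ƛ ƛ lt₁-body

    lt : ∀ {Δ} → Tm Δ (ℕ ⇒ ℕ ⇒ 𝔹)
    lt = ƛ rec lt₀ lt₁ v₀

  <ᵇ-unfold-0 : (n : Tm Γ ℕ) →
                HAω ∣ Φ ⊢ zero <ᵇ n ≐ rec false (ƛ ƛ true) n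
  <ᵇ-unfold-0 n = begin
    zero <ᵇ n               ≈⟨ ·-congˡ (β▸ ∅ (rec lt₀ lt₁ v₀)) ⟩
    rec lt₀ lt₁ zero · n    ≈⟨ ·-congˡ (ax (rec-0 _ _)) ⟩
    lt₀ · n                 ≈⟨ β▸ ∅ (rec false (ƛ ƛ true) v₀) ⟩
    rec false (ƛ ƛ true) n  ∎

  <ᵇ-unfold-suc : (m n : Tm Γ ℕ) →
                  HAω ∣ Φ ⊢ suc m <ᵇ n ≐ rec false (ƛ ƛ wk (wk (lt · m)) · v₁) n
  <ᵇ-unfold-suc m n = begin
    suc m <ᵇ n                               ≈⟨ ·-congˡ (β▸ ∅ (rec lt₀ lt₁ v₀)) ⟩
    rec lt₀ lt₁ (suc m) · n                  ≈⟨ ·-congˡ (ax (rec-s _ _ _)) ⟩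
    -- The recursive value is folded back into `lt · m`, so that the result speaks of `_<ᵇ_` again.
    -- The recursion equations for length, `_++_` and `_⋆_` are obtained by the same folding back.
    lt₁ · m · rec lt₀ lt₁ m · n              ≈⟨ ·-congˡ (·-congʳ (β▸ ∅ (rec lt₀ lt₁ v₀))) ⟨
    lt₁ · m · (lt · m) · n                   ≈⟨ β▸₃ ∅ lt₁-body ⟩
    rec false (ƛ ƛ wk (wk (lt · m)) · v₁) n  ∎

  0<ᵇ0 : HAω ∣ Φ ⊢ zero <ᵇ zero ≐ false
  0<ᵇ0 = ≐-trans (<ᵇ-unfold-0 zero) (ax (rec-0 _ _))

  suc<ᵇ0 : (m : Tm Γ ℕ) → HAω ∣ Φ ⊢ suc m <ᵇ zero ≐ false
  suc<ᵇ0 m = ≐-trans (<ᵇ-unfold-suc m zero) (ax (rec-0 _ _))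

  0<ᵇsuc : (n : Tm Γ ℕ) → HAω ∣ Φ ⊢ zero <ᵇ suc n ≐ true
  0<ᵇsuc n = ≐-trans (<ᵇ-unfold-0 (suc n)) (≐-trans (ax (rec-s _ _ _)) (β▸₂ ∅ true))

  suc<ᵇsuc : (m n : Tm Γ ℕ) → HAω ∣ Φ ⊢ suc m <ᵇ suc n ≐ m <ᵇ n
  suc<ᵇsuc m n =
    ≐-trans (<ᵇ-unfold-suc m (suc n))
      (≐-trans (ax (rec-s _ _ _)) (β▸₂ (∅ ▸ (lt · m)) (v₂ · v₁)))

  ∣nil∣ : HAω ∣ Φ ⊢ ∣ nil {X = X} ∣ ≐ zero
  ∣nil∣ = ≐-trans (β▸ ∅ (fold zero (ƛ ƛ ƛ suc v₀) v₀)) (ax (fold-n _ _))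

  ∣cons∣ : (x : Tm Γ X) (s : Tm Γ (X *)) → HAω ∣ Φ ⊢ ∣ cons x s ∣ ≐ suc ∣ s ∣
  ∣cons∣ x s = begin
    ∣ cons x s ∣                         ≈⟨ β▸ ∅ body ⟩
    fold zero step (cons x s)            ≈⟨ ax (fold-c _ _ _ _) ⟩
    step · x · s · fold zero step s      ≈⟨ ·-congʳ (β▸ ∅ body) ⟨
    step · x · s · ∣ s ∣                 ≈⟨ β▸₃ ∅ (suc v₀) ⟩
    suc ∣ s ∣                            ∎
    where
    step : ∀ {Δ} → Tm Δ (X ⇒ X * ⇒ ℕ ⇒ ℕ)
    step = ƛ ƛ ƛ suc v₀
    body : ∀ {Δ} → Tm (X * ∷ Δ) ℕ
    body = fold zero step v₀

  nil-++ : (t : Tm Γ (X *)) → HAω ∣ Φ ⊢ nil ++ t ≐ t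
  nil-++ t = ≐-trans (β▸₂ ∅ (fold v₀ (ƛ ƛ ƛ cons v₂ v₀) v₁)) (ax (fold-n _ _))

  cons-++ : (x : Tm Γ X) (s t : Tm Γ (X *)) →
            HAω ∣ Φ ⊢ cons x s ++ t ≐ cons x (s ++ t)
  cons-++ x s t = begin
    cons x s ++ t                ≈⟨ β▸₂ ∅ body ⟩
    fold t step (cons x s)       ≈⟨ ax (fold-c _ _ _ _) ⟩
    step · x · s · fold t step s ≈⟨ ·-congʳ (β▸₂ ∅ body) ⟨
    step · x · s · (s ++ t)      ≈⟨ β▸₃ ∅ (cons v₂ v₀) ⟩
    cons x (s ++ t)              ∎
    where
    step : ∀ {Δ} → Tm Δ (X ⇒ X * ⇒ X * ⇒ X *)
    step = ƛ ƛ ƛ cons v₂ v₀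
    body : ∀ {Δ} → Tm (X * ∷ X * ∷ Δ) (X *)
    body = fold v₀ step v₁

  private
    prefix-body : ∀ {Δ} → Tm (X ^ω ∷ X * ∷ X ∷ Δ) (X ^ω)
    prefix-body = ƛ rec v₃ (ƛ ƛ v₃ · v₁) v₀

    ⋆-step : ∀ {Δ} → Tm Δ (X ⇒ X * ⇒ X ^ω ⇒ X ^ω)
    ⋆-step = ƛ ƛ ƛ prefix-body

    ⋆-body : ∀ {Δ} → Tm (X ^ω ∷ X * ∷ Δ) (X ^ω)
    ⋆-body = fold v₀ ⋆-step v₁

  nil-⋆ : (α : Tm Γ (X ^ω)) → HAω ∣ Φ ⊢ nil ⋆ α ≐ α
  nil-⋆ α = ≐-trans (β▸₂ ∅ ⋆-body) (ax (fold-n _ _))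

  cons-⋆-unfold : (x : Tm Γ X) (s : Tm Γ (X *)) (α : Tm Γ (X ^ω)) →
                  HAω ∣ Φ ⊢ cons x s ⋆ α
                          ≐ (ƛ rec (wk x) (ƛ ƛ wk (wk (wk (s ⋆ α))) · v₁) v₀)
  cons-⋆-unfold x s α = begin
    cons x s ⋆ α                         ≈⟨ β▸₂ ∅ ⋆-body ⟩
    fold α ⋆-step (cons x s)             ≈⟨ ax (fold-c _ _ _ _) ⟩
    ⋆-step · x · s · fold α ⋆-step s     ≈⟨ ·-congʳ (β▸₂ ∅ ⋆-body) ⟨
    ⋆-step · x · s · (s ⋆ α)             ≈⟨ β▸₃ ∅ prefix-body ⟩
    sub (∅ ▸ x ▸ s ▸ (s ⋆ α)) prefix-body ∎

  ⟨⟩-⋆-unfold : (x : Tm Γ X) (α : Tm Γ (X ^ω)) →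
                HAω ∣ Φ ⊢ ⟨ x ⟩ ⋆ α ≐ (ƛ rec (wk x) (ƛ ƛ wk (wk (wk α)) · v₁) v₀)
  ⟨⟩-⋆-unfold x α =
    ≐-trans (cons-⋆-unfold x nil α) (cong▸ (∅ ▸ x ▸ nil) prefix-body (nil-⋆ α))

  -- Both sides unfold to the same abstraction, as `⟨ x ⟩` ends in `nil`. Every law of `_⋆_` thereby
  -- reduces to prepending a single entry, whose values at zero and at successors follow.
  cons-⋆ : (x : Tm Γ X) (s : Tm Γ (X *)) (α : Tm Γ (X ^ω)) →
           HAω ∣ Φ ⊢ cons x s ⋆ α ≐ ⟨ x ⟩ ⋆ (s ⋆ α)
  cons-⋆ x s α = ≐-trans (cons-⋆-unfold x s α) (≐-sym (⟨⟩-⋆-unfold x (s ⋆ α)))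

  ⟨⟩-⋆-zero : (x : Tm Γ X) (α : Tm Γ (X ^ω)) → HAω ∣ Φ ⊢ (⟨ x ⟩ ⋆ α) · zero ≐ x
  ⟨⟩-⋆-zero x α =
    ≐-trans (·-congˡ (⟨⟩-⋆-unfold x α))
      (≐-trans (β▸ (∅ ▸ x ▸ α) (rec v₂ (ƛ ƛ v₃ · v₁) v₀)) (ax (rec-0 _ _)))

  ⟨⟩-⋆-suc : (x : Tm Γ X) (α : Tm Γ (X ^ω)) (n : Tm Γ ℕ) →
             HAω ∣ Φ ⊢ (⟨ x ⟩ ⋆ α) · suc n ≐ α · n
  ⟨⟩-⋆-suc x α n =
    ≐-trans (·-congˡ (⟨⟩-⋆-unfold x α))
      (≐-trans (β▸ (∅ ▸ x ▸ α) (rec v₂ (ƛ ƛ v₃ · v₁) v₀))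
        (≐-trans (ax (rec-s _ _ _)) (β▸₂ (∅ ▸ α) (v₂ · v₁))))

  ＠-unfold : (s : Tm Γ (X *)) (α : Tm Γ (X ^ω)) (i : Tm Γ ℕ) →
             HAω ∣ Φ ⊢ (s ＠ α) · i ≐ (if i <ᵇ ∣ s ∣ then s ‼ i else α · i)
  ＠-unfold s α i =
    cast
      (cong₂ (λ o z → o · s · α · i ≐ (if i <ᵇ ∣ s ∣ then (s ⋆ (ƛ z)) · i else α · i))
             (sub-overwrite ∅) (sub-𝟎 _))
      (β▸₃ ∅ (if v₀ <ᵇ ∣ v₂ ∣ then v₂ ‼ v₀ else v₁ · v₀))

  ⟪⟫-unfold : (q : Tm Γ (X ^ω ⇒ A)) (s : Tm Γ (X *)) →
              HAω ∣ Φ ⊢ q ⟪ s ⟫ ≐ (ƛ wk q · (wk s ⋆ v₀))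
  ⟪⟫-unfold q s = β▸₂ ∅ (ƛ v₂ · (v₁ ⋆ v₀))

  ⟪⟫-· : (q : Tm Γ (X ^ω ⇒ A)) (s : Tm Γ (X *)) (α : Tm Γ (X ^ω)) →
         HAω ∣ Φ ⊢ q ⟪ s ⟫ · α ≐ q · (s ⋆ α)
  ⟪⟫-· q s α = β▸₃ ∅ (v₂ · (v₁ ⋆ v₀))

  if-≐-true : {b : Tm Γ 𝔹} {t u : Tm Γ A} →
              HAω ∣ Φ ⊢ b ≐ true → HAω ∣ Φ ⊢ (if b then t else u) ≐ t
  if-≐-true d = ≐-trans (if-cong d ≐I ≐I) (ax (if-t _ _))

  if-≐-false : {b : Tm Γ 𝔹} {t u : Tm Γ A} →
               HAω ∣ Φ ⊢ b ≐ false → HAω ∣ Φ ⊢ (if b then t else u) ≐ u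
  if-≐-false d = ≐-trans (if-cong d ≐I ≐I) (ax (if-f _ _))

-- The test against length zero computes to `false` only once the position is known to be zero or a
-- successor, hence the case distinction through `ext-ℕ`.
nil-＠ : (α : Tm Γ (X ^ω)) → HAω ∣ Φ ⊢ nil ＠ α ≐ α
nil-＠ α = ext-ℕ (wk-＠ nil α) refl (at 0<ᵇ0) (at (suc<ᵇ0 v₀))
  where
  at : ∀ {Γ} {Φ : List (Fm Γ)} {α : Tm Γ (X ^ω)} {i} →
       HAω ∣ Φ ⊢ i <ᵇ zero ≐ false → HAω ∣ Φ ⊢ (nil ＠ α) · i ≐ α · i
  at d = ≐-trans (＠-unfold _ _ _) (if-≐-false (≐-trans (·-congʳ ∣nil∣) d))

-- The recursion equation of overwriting: position zero lies inside the prefix, so `y` is lost, and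
-- at a successor both the test and the lookup pass to the predecessor. The entry `y` is arbitrary
-- because it is needed both as `x` itself and as `𝟎`.
cons-＠ : (x y : Tm Γ X) (s : Tm Γ (X *)) (α : Tm Γ (X ^ω)) →
         HAω ∣ Φ ⊢ cons x s ＠ (⟨ y ⟩ ⋆ α) ≐ ⟨ x ⟩ ⋆ (s ＠ α)
cons-＠ {X = X} x y s α =
  ext-ℕ (wk-＠ (cons x s) (⟨ y ⟩ ⋆ α)) (cong (⟨ wk x ⟩ ⋆_) (wk-＠ s α))
        at-0 (at-suc (wk x) (wk y) (wk s) (wk α) v₀)
  where
  open ≐-Reasoning
  at-0 : HAω ∣ Φ ⊢ (cons x s ＠ (⟨ y ⟩ ⋆ α)) · zero ≐ (⟨ x ⟩ ⋆ (s ＠ α)) · zero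
  at-0 = begin
    (cons x s ＠ (⟨ y ⟩ ⋆ α)) · zero  ≈⟨ ＠-unfold _ _ _ ⟩
    _                                ≈⟨ if-≐-true (≐-trans (·-congʳ (∣cons∣ x s)) (0<ᵇsuc _)) ⟩
    (cons x s ⋆ 𝟎) · zero            ≈⟨ ·-congˡ (cons-⋆ x s 𝟎) ⟩
    (⟨ x ⟩ ⋆ (s ⋆ 𝟎)) · zero         ≈⟨ ⟨⟩-⋆-zero x _ ⟩
    x                                ≈⟨ ⟨⟩-⋆-zero x _ ⟨
    (⟨ x ⟩ ⋆ (s ＠ α)) · zero         ∎
  at-suc : ∀ {Γ} {Φ : List (Fm Γ)} (x y : Tm Γ X) s α n →
           HAω ∣ Φ ⊢ (cons x s ＠ (⟨ y ⟩ ⋆ α)) · suc n ≐ (⟨ x ⟩ ⋆ (s ＠ α)) · suc n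
  at-suc x y s α n = begin
    (cons x s ＠ (⟨ y ⟩ ⋆ α)) · suc n
      ≈⟨ ＠-unfold _ _ _ ⟩
    (if suc n <ᵇ ∣ cons x s ∣ then cons x s ‼ suc n else (⟨ y ⟩ ⋆ α) · suc n)
      ≈⟨ if-cong (≐-trans (·-congʳ (∣cons∣ x s)) (suc<ᵇsuc n ∣ s ∣))
                 (≐-trans (·-congˡ (cons-⋆ x s 𝟎)) (⟨⟩-⋆-suc x _ n))
                 (⟨⟩-⋆-suc y α n) ⟩
    (if n <ᵇ ∣ s ∣ then s ‼ n else α · n)
      ≈⟨ ＠-unfold s α n ⟨
    (s ＠ α) · n
      ≈⟨ ⟨⟩-⋆-suc x _ n ⟨
    (⟨ x ⟩ ⋆ (s ＠ α)) · suc n ∎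

-- The zero sequence is its own tail. This is why overwriting, which keeps positions, and
-- concatenation, which shifts them, agree on `𝟎`.
⟨𝟎⟩⋆𝟎 : HAω ∣ Φ ⊢ ⟨ 𝟎 {A = X} ⟩ ⋆ 𝟎 ≐ 𝟎 {Γ = Γ}
⟨𝟎⟩⋆𝟎 = ext-ℕ (cong₂ (λ y z → ⟨ y ⟩ ⋆ (ƛ z)) (ren-𝟎 _) (ren-𝟎 _)) (cong ƛ_ (ren-𝟎 _))
  (≐-trans (⟨⟩-⋆-zero 𝟎 𝟎) (≐-sym 𝟎-·))
  (≐-trans (⟨⟩-⋆-suc 𝟎 𝟎 v₀) (≐-trans 𝟎-· (≐-sym 𝟎-·)))
  where
  𝟎-· : {n : Tm Γ ℕ} → HAω ∣ Φ ⊢ 𝟎 · n ≐ 𝟎 {A = X}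
  𝟎-· {n = n} = ≐-trans (ax (β 𝟎 n)) (≐-reflexive (sub-𝟎 (var ▸ n)))

-- The common induction step of the next two lemmas, with `γ` being `s ⋆ α` in the first and both
-- `γ` and `α` being `𝟎` in the second.
cons-＠-⋆ : (x y : Tm Γ X) (s : Tm Γ (X *)) {α γ : Tm Γ (X ^ω)} →
           HAω ∣ Φ ⊢ s ＠ γ ≐ s ⋆ α → HAω ∣ Φ ⊢ cons x s ＠ (⟨ y ⟩ ⋆ γ) ≐ cons x s ⋆ α
cons-＠-⋆ x y s d =
  ≐-trans (cons-＠ x y s _) (≐-trans (·-congʳ d) (≐-sym (cons-⋆ x s _)))

-- In both inductions `overwrite` enters the formula as a variable, because
-- substitution does not compute on the 𝟎 inside it.

＠-⋆ : (s : Tm Γ (X *)) (α : Tm Γ (X ^ω)) → HAω ∣ Φ ⊢ s ＠ (s ⋆ α) ≐ s ⋆ α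
＠-⋆ {Φ = Φ} s α =
  ind*▸ (∅ ▸ overwrite ▸ α) (v₂ · v₀ · (v₀ ⋆ v₁) ≐ v₀ ⋆ v₁) (nil-＠ _)
    (subst (λ o → HAω ∣ o · v₀ · (v₀ ⋆ wk (wk α)) ≐ v₀ ⋆ wk (wk α) ∷ map wkᶠ (map wkᶠ Φ)
                    ⊢ o · cons v₁ v₀ · (cons v₁ v₀ ⋆ wk (wk α)) ≐ cons v₁ v₀ ⋆ wk (wk α))
      (sym (trans (cong wk wk-overwrite) wk-overwrite))
      (≐-trans (·-congʳ (cons-⋆ v₁ v₀ _)) (cons-＠-⋆ v₁ v₁ v₀ (hyp (here refl)))))
    s

＠-𝟎 : (s : Tm Γ (X *)) → HAω ∣ Φ ⊢ s ＠ 𝟎 ≐ s ⋆ 𝟎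
＠-𝟎 {Φ = Φ} s =
  ind*▸ (∅ ▸ overwrite ▸ 𝟎) (v₂ · v₀ · v₁ ≐ v₀ ⋆ v₁)
    (≐-trans (nil-＠ 𝟎) (≐-sym (nil-⋆ 𝟎)))
    (subst₂ (λ o z → HAω ∣ o · v₀ · z ≐ v₀ ⋆ z ∷ map wkᶠ (map wkᶠ Φ)
                       ⊢ o · cons v₁ v₀ · z ≐ cons v₁ v₀ ⋆ z)
      (sym (trans (cong wk wk-overwrite) wk-overwrite))
      (sym (trans (cong wk (ren-𝟎 there)) (ren-𝟎 there)))
      (≐-trans (·-congʳ (≐-sym ⟨𝟎⟩⋆𝟎)) (cons-＠-⋆ v₁ 𝟎 v₀ (hyp (here refl)))))
    s

-- By induction on `s`, peeling off heads with `cons-⋆` and `cons-++`. It moves an entry from the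
-- infinite part into the finite prefix, both in the outcome function and in the sequence that `EPS`
-- produces.
⋆-⟨⟩-⋆ : (s : Tm Γ (X *)) (x : Tm Γ X) (α : Tm Γ (X ^ω)) →
         HAω ∣ Φ ⊢ s ⋆ (⟨ x ⟩ ⋆ α) ≐ (s ++ ⟨ x ⟩) ⋆ α
⋆-⟨⟩-⋆ s x α =
  ind*▸ (∅ ▸ x ▸ α) (v₀ ⋆ (⟨ v₂ ⟩ ⋆ v₁) ≐ (v₀ ++ ⟨ v₂ ⟩) ⋆ v₁)
    (≐-trans (nil-⋆ _) (≐-sym (·-congˡ (·-congʳ (nil-++ _)))))
    (begin
      cons v₁ v₀ ⋆ (⟨ x′ ⟩ ⋆ α′)         ≈⟨ cons-⋆ _ _ _ ⟩
      ⟨ v₁ ⟩ ⋆ (v₀ ⋆ (⟨ x′ ⟩ ⋆ α′))      ≈⟨ ·-congʳ (hyp (here refl)) ⟩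
      ⟨ v₁ ⟩ ⋆ ((v₀ ++ ⟨ x′ ⟩) ⋆ α′)     ≈⟨ cons-⋆ _ _ _ ⟨
      cons v₁ (v₀ ++ ⟨ x′ ⟩) ⋆ α′        ≈⟨ ·-congˡ (·-congʳ (cons-++ _ _ _)) ⟨
      (cons v₁ v₀ ++ ⟨ x′ ⟩) ⋆ α′        ∎)
    s
  where
  open ≐-Reasoning
  x′ = wk (wk x)
  α′ = wk (wk α)

-- The conditional of `EPS` ends up below `s ⋆_`, whereas that of `SBR` is outermost; a case
-- distinction on the boolean lets them commute.
⋆-if : (s : Tm Γ (X *)) (b : Tm Γ 𝔹) (α γ : Tm Γ (X ^ω)) →
       HAω ∣ Φ ⊢ s ⋆ (if b then α else γ) ≐ (if b then s ⋆ α else s ⋆ γ)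
⋆-if s b α γ =
  case▸ (∅ ▸ s ▸ α ▸ γ)
    (v₃ ⋆ (if v₀ then v₂ else v₁) ≐ (if v₀ then v₃ ⋆ v₂ else v₃ ⋆ v₁))
    (≐-trans (·-congʳ (ax (if-t _ _))) (≐-sym (ax (if-t _ _))))
    (≐-trans (·-congʳ (ax (if-f _ _))) (≐-sym (ax (if-f _ _))))
    b

-- Spector's bar recursion

prepend : Tm Γ (X *) → Tm Γ (X ^ω ⇒ X ^ω)
prepend s = ƛ wk s ⋆ v₀

wk-prepend : (s : Tm Γ (X *)) → wk {A = A} (prepend s) ≡ prepend (wk s)
wk-prepend s =
  cong (λ u → ƛ u ⋆ v₀) (trans (ren-wk (liftᴿ there) s) (sym (ren-wk there s)))

prepend-· : (s : Tm Γ (X *)) (α : Tm Γ (X ^ω)) → HAω ∣ Φ ⊢ prepend s · α ≐ s ⋆ α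
prepend-· s α = β▸ (∅ ▸ s) (v₁ ⋆ v₀)

-- The outcome functions `prepend s` are closed under passing from `q` to `q_x`. The outcome
-- argument of each recursive call is thus determined by its finite sequence, which is all that
-- `SBR` carries along.
prepend-⟪⟫ : (s : Tm Γ (X *)) (x : Tm Γ X) →
             HAω ∣ Φ ⊢ prepend s ⟪ ⟨ x ⟩ ⟫ ≐ prepend (s ++ ⟨ x ⟩)
prepend-⟪⟫ s x =
  ≐-trans (⟪⟫-unfold (prepend s) ⟨ x ⟩)
    (ξ (≐-trans (·-congˡ (≐-reflexive (wk-prepend s)))
         (≐-trans (prepend-· (wk s) _) (⋆-⟨⟩-⋆ (wk s) (wk x) v₀))))

sbr-body : Tm (X * ⇒ J (X ^ω) X ∷ X * ∷ X ^ω ⇒ ℕ ∷ EPSTy X (X ^ω) ∷ Γ) (X ^ω)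
sbr-body = v₁ ⋆ (v₃ · v₂ · v₁ · v₀ · prepend v₁)

-- The term contains no `𝟎`, so weakening and substitution carry it to another context by
-- computation alone.
sbr : Tm Γ (EPSTy X (X ^ω) ⇒ SBRTy X)
sbr = ƛ ƛ ƛ ƛ sbr-body

sbr-unfold : (F : Tm Γ (EPSTy X (X ^ω))) (ω : Tm Γ (X ^ω ⇒ ℕ)) (s : Tm Γ (X *))
             (ε : Tm Γ (X * ⇒ J (X ^ω) X)) →
             HAω ∣ Φ ⊢ sbr · F · ω · s · ε ≐ s ⋆ (F · ω · s · ε · prepend s)
sbr-unfold F ω s ε =
  ≐-trans (·-congˡ (β▸₃ ∅ (ƛ sbr-body))) (β▸ (∅ ▸ F ▸ ω ▸ s) sbr-body)

-- The selection function of `EPS` is fed outcomes rather than bare tails: applying `q_x` restores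
-- the prefix `s ++ ⟨ x ⟩`, which yields exactly the recursive value of `SBR`.
prepend-⟪⟫-· : (F : Tm Γ (EPSTy X (X ^ω))) (ω : Tm Γ (X ^ω ⇒ ℕ)) (s : Tm Γ (X *))
               (ε : Tm Γ (X * ⇒ J (X ^ω) X)) (x : Tm Γ X) →
  HAω ∣ Φ ⊢ prepend s ⟪ ⟨ x ⟩ ⟫ · (F · ω · (s ++ ⟨ x ⟩) · ε · prepend s ⟪ ⟨ x ⟩ ⟫)
          ≐ sbr · F · ω · (s ++ ⟨ x ⟩) · ε
prepend-⟪⟫-· F ω s ε x =
  ≐-trans (·-cong (prepend-⟪⟫ s x) (·-congʳ (prepend-⟪⟫ s x)))
    (≐-trans (prepend-· (s ++ ⟨ x ⟩) _) (≐-sym (sbr-unfold F ω (s ++ ⟨ x ⟩) ε)))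

module _ {Γ} {Φ : List (Fm Γ)} (F : Tm Γ (EPSTy X (X ^ω))) (ω : Tm Γ (X ^ω ⇒ ℕ))
         (s : Tm Γ (X *)) (ε : Tm Γ (X * ⇒ J (X ^ω) X)) where

  open ≐-Reasoning

  -- One unfolding of `EPS`, at the outcome function `prepend s`, yields one unfolding of `SBR`; no
  -- bar induction is involved.
  sbr-SBREq : HAω ∣ Φ ⊢ EPSEq F ω s ε (prepend s) → HAω ∣ Φ ⊢ SBREq (sbr · F) ω s ε
  sbr-SBREq eps = begin
    sbr · F · ω · s · ε
      ≈⟨ sbr-unfold F ω s ε ⟩
    s ⋆ (F · ω · s · ε · prepend s)
      ≈⟨ ·-congʳ eps ⟩
    s ⋆ (if ω · (prepend s · 𝟎) <ᵇ ∣ s ∣ then 𝟎 else ⟨ c ⟩ ⋆ E (prepend s ⟪ ⟨ c ⟩ ⟫))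
      ≈⟨ ⋆-if s _ _ _ ⟩
    (if ω · (prepend s · 𝟎) <ᵇ ∣ s ∣ then s ⋆ 𝟎 else s ⋆ (⟨ c ⟩ ⋆ E (prepend s ⟪ ⟨ c ⟩ ⟫)))
      ≈⟨ if-cong (·-congˡ (·-congʳ guard)) (≐-sym (＠-𝟎 s)) continue ⟩
    (if (ω ⟪ s ⟫) · 𝟎 <ᵇ ∣ s ∣ then s ＠ 𝟎 else s ＠ (sbr · F · ω · (s ++ ⟨ c′ ⟩) · ε)) ∎
    where
    c c′ : Tm Γ X
    c  = ε · s · (ƛ (wk (prepend s) ⟪ ⟨ v₀ ⟩ ⟫)
                      · (wk F · wk ω · (wk s ++ ⟨ v₀ ⟩) · wk ε · (wk (prepend s) ⟪ ⟨ v₀ ⟩ ⟫)))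
    c′ = ε · s · (ƛ sbr · wk F · wk ω · (wk s ++ ⟨ v₀ ⟩) · wk ε)

    E : Tm Γ (X ^ω ⇒ X ^ω) → Tm Γ (X ^ω)
    E q = F · ω · (s ++ ⟨ c ⟩) · ε · q

    guard : HAω ∣ Φ ⊢ ω · (prepend s · 𝟎) ≐ (ω ⟪ s ⟫) · 𝟎
    -- The control is applied to the outcome of `𝟎`, which is `s ⋆ 𝟎`, so the two stopping tests
    -- agree.
    guard = ≐-trans (·-congʳ (prepend-· s 𝟎)) (≐-sym (⟪⟫-· ω s 𝟎))

    c≐c′ : HAω ∣ Φ ⊢ c ≐ c′
    -- The two functions given to `ε · s` agree at a fresh entry, hence are equal by extensionality,
    -- and so are the chosen entries.
    c≐c′ = ·-congʳ (ξ
      (cast (cong (λ q → q ⟪ ⟨ v₀ ⟩ ⟫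
                           · (wk F · wk ω · (wk s ++ ⟨ v₀ ⟩) · wk ε · q ⟪ ⟨ v₀ ⟩ ⟫)
                         ≐ sbr · wk F · wk ω · (wk s ++ ⟨ v₀ ⟩) · wk ε)
                  (sym (wk-prepend s))) (prepend-⟪⟫-· (wk F) (wk ω) (wk s) (wk ε) v₀)))

    continue : HAω ∣ Φ ⊢ s ⋆ (⟨ c ⟩ ⋆ E (prepend s ⟪ ⟨ c ⟩ ⟫))
                       ≐ s ＠ (sbr · F · ω · (s ++ ⟨ c′ ⟩) · ε)
    continue = begin
      s ⋆ (⟨ c ⟩ ⋆ E (prepend s ⟪ ⟨ c ⟩ ⟫))
        ≈⟨ ·-congʳ (·-congʳ (·-congʳ (prepend-⟪⟫ s c))) ⟩
      s ⋆ (⟨ c ⟩ ⋆ E (prepend (s ++ ⟨ c ⟩)))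
        -- Used from right to left, this creates the outer overwriting by `s` that `SBR` demands.
        -- The inner `s ⋆_` stays and next absorbs `c` into the prefix.
        ≈⟨ ＠-⋆ s _ ⟨
      s ＠ (s ⋆ (⟨ c ⟩ ⋆ E (prepend (s ++ ⟨ c ⟩))))
        ≈⟨ ·-congʳ (⋆-⟨⟩-⋆ s c _) ⟩
      s ＠ ((s ++ ⟨ c ⟩) ⋆ E (prepend (s ++ ⟨ c ⟩)))
        ≈⟨ ·-congʳ (sbr-unfold F ω (s ++ ⟨ c ⟩) ε) ⟨
      s ＠ (sbr · F · ω · (s ++ ⟨ c ⟩) · ε)
        ≈⟨ ·-congʳ (·-congˡ (·-congʳ (·-congʳ (⟨⟩-cong c≐c′)))) ⟩
      s ＠ (sbr · F · ω · (s ++ ⟨ c′ ⟩) · ε) ∎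

-- `subᶠ` does not compute on the 𝟎 in the two equations.

EPSEq-instance : (σ : Sub (A ^ω ⇒ B ∷ A * ⇒ J B A ∷ A * ∷ B ⇒ ℕ ∷ EPSTy A B ∷ Γ) Δ) →
                 subᶠ σ (EPSEq v₄ v₃ v₂ v₁ v₀)
                   ≡ EPSEq (sub σ v₄) (sub σ v₃) (sub σ v₂) (sub σ v₁) (sub σ v₀)
EPSEq-instance σ =
  cong (λ z → F · ℓ · s · ε · q
                ≐ (if ℓ · (q · z) <ᵇ ∣ s ∣ then z
                   else ⟨ c ⟩ ⋆ (F · ℓ · (s ++ ⟨ c ⟩) · ε · q ⟪ ⟨ c ⟩ ⟫)))
       (sub-𝟎 σ)
  where
  F = sub σ v₄
  ℓ = sub σ v₃
  s = sub σ v₂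
  ε = sub σ v₁
  q = sub σ v₀
  c = ε · s · (ƛ (wk q ⟪ ⟨ v₀ ⟩ ⟫)
                 · (wk F · wk ℓ · (wk s ++ ⟨ v₀ ⟩) · wk ε · (wk q ⟪ ⟨ v₀ ⟩ ⟫)))

SBREq-instance : (σ : Sub (X * ⇒ J (X ^ω) X ∷ X * ∷ X ^ω ⇒ ℕ ∷ SBRTy X ∷ Γ) Δ) →
                 subᶠ σ (SBREq v₃ v₂ v₁ v₀)
                   ≡ SBREq (sub σ v₃) (sub σ v₂) (sub σ v₁) (sub σ v₀)
SBREq-instance σ =
  cong₂ (λ z o → F · ω · s · ε
                   ≐ (if (ω ⟪ s ⟫) · z <ᵇ ∣ s ∣ then o · s · z
                      else o · s · (F · ω · (s ++ ⟨ c ⟩) · ε)))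
        (sub-𝟎 σ) (sub-overwrite σ)
  where
  F = sub σ v₃
  ω = sub σ v₂
  s = sub σ v₁
  ε = sub σ v₀
  c = ε · s · (ƛ wk F · wk ω · (wk s ++ ⟨ v₀ ⟩) · wk ε)

theorem3p18 : EPS ≥T SBR over HAω
theorem3p18 X = (X , X ^ω) , sbr ,
  ∀I (∀I (∀I (cast (sym (SBREq-instance _))
    (sbr-SBREq v₃ v₂ v₁ v₀
      (cast (EPSEq-instance (wk³ ▸ v₂ ▸ v₁ ▸ v₀ ▸ prepend v₁))
        -- Introducing `ω`, `s` and `ε` weakened the hypothesis three times; `wk³-equation` presents
        -- this as a substitution, so that the four quantifiers can be instantiated with `ω`, `s`,
        -- `ε` and the outcome function `prepend v₁`, where `v₁` is `s`.
        (∀E▸₄ wk³ (EPSEq v₄ v₃ v₂ v₁ v₀)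
          (cast (wk³-equation (Functional.equation EPS (X , X ^ω))) (hyp (here refl)))
          v₂ v₁ v₀ (prepend v₁)))))))
  where
  wk³ : Sub Γ (A ∷ B ∷ C ∷ Γ)
  wk³ x = var (there (there (there x)))

  wk³-equation : (φ : Fm Γ) → wkᶠ {A = A} (wkᶠ {A = B} (wkᶠ {A = C} φ)) ≡ subᶠ wk³ φ
  wk³-equation φ =
    trans (cong (λ ψ → wkᶠ (wkᶠ ψ)) (sym (subᶠ-as-renᶠ (λ _ → refl) φ)))
      (trans (cong wkᶠ (wkᶠ-subᶠ (λ x → var (there x)) φ))
             (wkᶠ-subᶠ (λ x → var (there (there x))) φ))
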